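{- Let $n,p$ be positive coprime integers and let $x,y\in\mathfrak D_{n,p}$ be rational Dyck paths such that $d_{i,j}(x)=d_{i,j}(y)$ for all $i,j\in[n]$ with $i<j$. Then $x=y$.
   Context: A rational Dyck path is a lattice path from $(0,0)$ with $n$ North steps $(0,1)$ and $p$ East steps $(1,0)$ never going below the line of slope $n/p$ through the origin; $\mathfrak D_{n,p}$ is the set of these. The unit square with bottom-right corner $(i,j)$ gets label $\ell_{i,j}=jp-in$; each step of a path gets the label of its starting point $(i,j)$. Let $\ell_1<\dots<\ell_n$ be the labels of the North steps of $x$, and $H(x)$ the set of positive labels of unit squares lying below $x$ (between $x$ and the diagonal). The codinv tableau of $x$ is $d_{i,j}(x)=\#\{h\in H(x):\ell_i<h<\ell_i+p,\ h\equiv\ell_j\pmod n\}$ for $i<j$ in $[n]$. -}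

module Defs where

open import Data.Nat as ℕ using (ℕ; zero; suc; _∸_; _≤_)
open import Data.Nat.Divisibility using (_∣?_)
open import Data.Integer as ℤ using (ℤ; +_; _-_; ∣_∣) renaming (_+_ to _+ℤ_; _<_ to _<ℤ_; _<?_ to _<ℤ?_)
open import Data.Integer.Properties using (≤-decTotalOrder; _≟_)
open import Data.List using (List; []; _∷_; length; filter; map; upTo; concatMap)
open import Data.Bool.ListAction using (any)
open import Data.List.Relation.Unary.All using (All)
open import Data.List.Relation.Unary.Any using (Any)
open import Data.List.Sort (≤-decTotalOrder) using (sort)
open import Data.Product using (_×_; _,_)
open import Data.Bool using (Bool; true; false; _∧_; T?)
open import Relation.Nullary.Decidable using (⌊_⌋; _×-dec_)
open import Relation.Binary.PropositionalEquality using (_≡_)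

data Step : Set where
  N E : Step

countN countE : List Step → ℕ
countN []       = 0
countN (N ∷ s)  = suc (countN s)
countN (E ∷ s)  = countN s
countE []       = 0
countE (N ∷ s)  = countE s
countE (E ∷ s)  = suc (countE s)

pointsFrom : ℕ → ℕ → List Step → List (ℕ × ℕ)
pointsFrom x y []      = (x , y) ∷ []
pointsFrom x y (N ∷ s) = (x , y) ∷ pointsFrom x (suc y) s
pointsFrom x y (E ∷ s) = (x , y) ∷ pointsFrom (suc x) y s

points : List Step → List (ℕ × ℕ)
points = pointsFrom 0 0

-- Rational Dyck path in 𝔇_{n,p}: n North steps, p East steps, every visited
-- lattice point (x , y) weakly above the line y = (n/p) x, i.e. n x ≤ p y.
record DyckPath (n p : ℕ) : Set where
  constructor dyck
  field
    path    : List Step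
    numN    : countN path ≡ n
    numE    : countE path ≡ p
    aboveDiag : All (λ { (x , y) → n ℕ.* x ≤ p ℕ.* y }) (points path)
open DyckPath public

-- Label of the unit square with bottom-right corner (i , j), also the label of
-- a step starting at the lattice point (i , j):  ℓ_{i,j} = j p - i n.
label : ℕ → ℕ → ℕ → ℕ → ℤ
label n p i j = + (j ℕ.* p) - + (i ℕ.* n)

northStartsFrom : ℕ → ℕ → List Step → List (ℕ × ℕ)
northStartsFrom x y []      = []
northStartsFrom x y (N ∷ s) = (x , y) ∷ northStartsFrom x (suc y) s
northStartsFrom x y (E ∷ s) = northStartsFrom (suc x) y s

northStarts : List Step → List (ℕ × ℕ)
northStarts = northStartsFrom 0 0

northLabels : (n p : ℕ) → DyckPath n p → List ℤ
northLabels n p x = sort (map (λ { (i , j) → label n p i j }) (northStarts (path x)))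

nthOr : ℤ → List ℤ → ℕ → ℤ
nthOr d []       _       = d
nthOr d (a ∷ l)  zero    = a
nthOr d (a ∷ l)  (suc k) = nthOr d l k

-- ℓ_i for i ∈ [n] (1-based; index 0 is not used).
ℓ : (n p : ℕ) → DyckPath n p → ℕ → ℤ
ℓ n p x i = nthOr (+ 0) (northLabels n p x) (i ∸ 1)

-- Labels of all unit squares lying below the path inside the rectangle:
-- in row y (between heights y and y+1) the North step starts at (e , y);
-- the squares [a,a+1]×[y,y+1] with e ≤ a < p lie below the path; the
-- bottom-right corner of such a square is (a+1 , y).
belowLabels : (n p : ℕ) → List Step → List ℤ
belowLabels n p s =
  concatMap (λ { (e , y) →
    map (λ k → label n p (suc (e ℕ.+ k)) y) (upTo (p ∸ e)) }) (northStarts s)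

inH : (n p : ℕ) → DyckPath n p → ℤ → Bool
inH n p x h = ⌊ ℤ.0ℤ <ℤ? h ⌋ ∧ any (λ h' → ⌊ h ≟ h' ⌋) (belowLabels n p (path x))

-- Codinv tableau entry d_{i,j}(x)
--   = #{ h ∈ H(x) : ℓ_i < h < ℓ_i + p , h ≡ ℓ_j (mod n) }.
-- The integers strictly between ℓ_i and ℓ_i + p are ℓ_i + k, 1 ≤ k ≤ p-1.
-- h ≡ ℓ_j (mod n) is n ∣ |h - ℓ_j|.
codinv : (n p : ℕ) → DyckPath n p → ℕ → ℕ → ℕ
codinv n p x i j =
  length (filter (λ h → T? (inH n p x h ∧ ⌊ n ∣? ∣ h - ℓ n p x j ∣ ⌋))
                 (map (λ k → ℓ n p x i +ℤ + suc k) (upTo (p ∸ 1))))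

{-# OPTIONS --safe #-}
module Submission where

-- The labels v of the vertices form a closed walk: North steps v ↦ v + p, East steps v ↦ v - n.
-- Telescoping v ↦ ⌊(v ∸ c) / n⌋ and v ↦ ⌊(u ∸ v) / n⌋ along it shows that the i-th row sum of the
-- codinv tableau counts the East steps ending above ℓᵢ + p, and the j-th column sum counts the East
-- steps starting below ℓⱼ. So the tableau determines how North and East steps interleave, both when
-- sorted by starting label and when sorted by ending label. Starts and ends run over the same set of
-- labels, so these two interleavings determine the step that leaves the vertex of a given rank and
-- the rank of the vertex it reaches; following the steps from rank 0 recovers the path.

open import Defs
open import Data.Nat using (ℕ; zero; suc; _+_; _*_; _∸_; _≤_; _<_; z≤n; s≤s; NonZero; >-nonZero; >-nonZero⁻¹; ≢-nonZero⁻¹; _<?_; _≤?_)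
open import Data.Nat.Properties
open import Data.Nat.Divisibility using (_∣_; divides; _∣?_; ∣⇒≤; m∣m*n; n∣m*n)
open import Data.Nat.DivMod
open import Data.Nat.Coprimality using (Coprime; coprime-divisor)
open import Data.Nat.ListAction using (sum)
open import Data.Nat.ListAction.Properties using (sum-↭)
open import Data.Integer as ℤ using (ℤ; ∣_∣; _⊖_)
import Data.Integer.Properties as ℤₚ
open import Data.Nat.Tactic.RingSolver using (solve-∀)
open import Data.Bool using (true; false; T; T?; if_then_else_; _∧_)
open import Data.Bool.Properties using (T-∧)
open import Data.Bool.ListAction using (any)
open import Data.List using (List; []; _∷_; length; filter; map; upTo; applyUpTo)
open import Data.List.Properties using (map-upTo; map-∘; map-id; length-map)
open import Data.List.Membership.Propositional using (_∈_; find; lose)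
open import Data.List.Membership.Propositional.Properties using (∈-map⁺; ∈-map⁻; ∈-upTo⁺; ∈-upTo⁻; ∈-concatMap⁺; ∈-concatMap⁻)
open import Data.List.Relation.Binary.Permutation.Propositional using (_↭_; ↭-sym; ↭-reflexive; ↭-trans; ↭⇒↭ₛ)
open import Data.List.Relation.Binary.Permutation.Propositional.Properties using (map⁺; ∈-resp-↭; ↭-length)
import Data.List.Relation.Binary.Permutation.Setoid.Properties as PermS
open import Data.List.Relation.Unary.All as All using (All; []; _∷_)
open import Data.List.Relation.Unary.AllPairs as AllPairs using (AllPairs; []; _∷_)
import Data.List.Relation.Unary.AllPairs.Properties as AllPairsₚ
open import Data.List.Relation.Unary.Any as Any using (here; there)
open import Data.List.Relation.Unary.Any.Properties using (any⁺; any⁻)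
open import Data.List.Relation.Unary.Linked.Properties using (Linked⇒AllPairs)
open import Data.List.Sort ℤₚ.≤-decTotalOrder using (sort-↭; sort-↗)
open import Data.Product using (∃; _×_; _,_; proj₁; proj₂)
open import Data.Sum using (_⊎_; inj₁; inj₂)
open import Function using (_∘_; id; Equivalence)
open import Relation.Binary.Definitions using (tri<; tri≈; tri>)
open import Relation.Binary.PropositionalEquality hiding ([_])
open import Relation.Nullary using (¬_; Dec; yes; no; does; contradiction)
open import Relation.Nullary.Decidable using (⌊_⌋; _×-dec_; toWitness; fromWitness)

-- Sums over lists and indicator functions.

S : {A : Set} → (A → ℕ) → List A → ℕ
S f xs = sum (map f xs)

χ : {P : Set} → Dec P → ℕ
χ d = if does d then 1 else 0

χ-cong : {P Q : Set} (P? : Dec P) (Q? : Dec Q) → (P → Q) → (Q → P) → χ P? ≡ χ Q?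
χ-cong (yes _) (yes _) _ _ = refl
χ-cong (yes p) (no ¬q) f _ = contradiction (f p) ¬q
χ-cong (no ¬p) (yes q) _ g = contradiction (g q) ¬p
χ-cong (no _)  (no _)  _ _ = refl

χ-mono : {P Q : Set} (P? : Dec P) (Q? : Dec Q) → (P → Q) → χ P? ≤ χ Q?
χ-mono (yes _) (yes _) _ = ≤-refl
χ-mono (yes p) (no ¬q) f = contradiction (f p) ¬q
χ-mono (no _)  _       _ = z≤n

χ-yes : {P : Set} (P? : Dec P) → P → χ P? ≡ 1
χ-yes (yes _) _ = refl
χ-yes (no ¬p) p = contradiction p ¬p

χ-no : {P : Set} (P? : Dec P) → ¬ P → χ P? ≡ 0
χ-no (yes p) ¬p = contradiction p ¬p
χ-no (no _)  _  = refl

module _ {A : Set} where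

  S-cong : ∀ {f g : A → ℕ} xs → (∀ x → x ∈ xs → f x ≡ g x) → S f xs ≡ S g xs
  S-cong []       _ = refl
  S-cong (x ∷ xs) h = cong₂ _+_ (h x (here refl)) (S-cong xs λ y → h y ∘ there)

  S-mono : ∀ {f g : A → ℕ} xs → (∀ x → f x ≤ g x) → S f xs ≤ S g xs
  S-mono []       _ = z≤n
  S-mono (x ∷ xs) h = +-mono-≤ (h x) (S-mono xs h)

  S-strict : ∀ {f g : A → ℕ} {y} xs → (∀ x → f x ≤ g x) → y ∈ xs → f y < g y → S f xs < S g xs
  S-strict (x ∷ xs) h (here refl) lt = +-mono-<-≤ lt (S-mono xs h)
  S-strict (x ∷ xs) h (there y∈)  lt = +-mono-≤-< (h x) (S-strict xs h y∈ lt)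

  S-+ : ∀ (f g : A → ℕ) xs → S (λ x → f x + g x) xs ≡ S f xs + S g xs
  S-+ f g []       = refl
  S-+ f g (x ∷ xs) = begin
    f x + g x + S (λ y → f y + g y) xs ≡⟨ cong (f x + g x +_) (S-+ f g xs) ⟩
    f x + g x + (S f xs + S g xs)      ≡⟨ +-assoc-middle (f x) (g x) (S f xs) (S g xs) ⟩
    f x + S f xs + (g x + S g xs)      ∎
    where
    open ≡-Reasoning
    +-assoc-middle : ∀ a b c d → a + b + (c + d) ≡ a + c + (b + d)
    +-assoc-middle = solve-∀

  S-↭ : ∀ (f : A → ℕ) {xs ys} → xs ↭ ys → S f xs ≡ S f ys
  S-↭ f = sum-↭ ∘ map⁺ f

  S-one : ∀ xs → S {A} (λ _ → 1) xs ≡ length xs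
  S-one []       = refl
  S-one (x ∷ xs) = cong suc (S-one xs)

  length-filter-S : ∀ {P : A → Set} (P? : ∀ x → Dec (P x)) xs → length (filter P? xs) ≡ S (χ ∘ P?) xs
  length-filter-S P? []       = refl
  length-filter-S P? (x ∷ xs) with does (P? x)
  ... | true  = cong suc (length-filter-S P? xs)
  ... | false = length-filter-S P? xs

S-map : ∀ {A B : Set} (f : B → ℕ) (g : A → B) xs → S f (map g xs) ≡ S (f ∘ g) xs
S-map f g xs = cong sum (sym (map-∘ xs))

S-telescope : (e F : ℕ → ℕ) → (∀ k → F k ≡ e k + F (suc k)) → ∀ m → F 0 ≡ S e (upTo m) + F m
S-telescope e F step m = trans (go e F step m) (cong (λ l → sum l + F m) (sym (map-upTo e m)))
  where
  -- `applyUpTo` unfolds at the head, so the induction replaces `e` and `F` by their shifts.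
  go : (e F : ℕ → ℕ) → (∀ k → F k ≡ e k + F (suc k)) → ∀ m → F 0 ≡ sum (applyUpTo e m) + F m
  go e F step zero    = refl
  go e F step (suc m) = trans (step 0)
    (trans (cong (e 0 +_) (go (e ∘ suc) (F ∘ suc) (step ∘ suc) m)) (sym (+-assoc (e 0) _ _)))

#< : ℕ → List ℕ → ℕ
#< t = S (λ a → χ (a <? t))

#<-mono : ∀ {t u} xs → t ≤ u → #< t xs ≤ #< u xs
#<-mono xs t≤u = S-mono xs λ a → χ-mono (a <? _) (a <? _) λ a<t → <-≤-trans a<t t≤u

χ-<-strict : ∀ {t u} → t < u → χ (t <? t) < χ (t <? u)
χ-<-strict {t} {u} t<u = subst₂ _<_ (sym (χ-no (t <? t) (<-irrefl refl))) (sym (χ-yes (t <? u) t<u)) (s≤s z≤n)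

#<-strict : ∀ {t u} xs → t ∈ xs → t < u → #< t xs < #< u xs
#<-strict {t} xs t∈ t<u = S-strict xs (λ a → χ-mono (a <? _) (a <? _) λ a<t → <-trans a<t t<u) t∈ (χ-<-strict t<u)

#<-#≥ : ∀ t xs → #< t xs + S (λ a → χ (t ≤? a)) xs ≡ length xs
#<-#≥ t xs = trans (sym (S-+ _ _ xs)) (trans (S-cong xs λ a _ → split a) (S-one xs))
  where
  split : ∀ a → χ (a <? t) + χ (t ≤? a) ≡ 1
  split a with a <? t
  ... | yes a<t = cong₂ _+_ (χ-yes (a <? t) a<t) (χ-no (t ≤? a) (<⇒≱ a<t))
  ... | no a≮t  = cong₂ _+_ (χ-no (a <? t) a≮t) (χ-yes (t ≤? a) (≮⇒≥ a≮t))

-- Quotients and residues modulo `n`.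

module _ (n : ℕ) {{_ : NonZero n}} where

  -- For `m < n` truncated subtraction makes both quotients vanish. This gives the jump of a
  -- telescoped quotient along an East step.
  /-step : ∀ m → m / n ≡ χ (n ≤? m) + (m ∸ n) / n
  /-step m with n ≤? m
  ... | yes n≤m = trans (m/n≡1+[m∸n]/n n≤m) (cong (_+ (m ∸ n) / n) (sym (χ-yes (n ≤? m) n≤m)))
  ... | no n≰m  = trans (m<n⇒m/n≡0 m<n) (sym (cong₂ _+_ (χ-no (n ≤? m) n≰m) (trans (cong (_/ n) (m≤n⇒m∸n≡0 (<⇒≤ m<n))) (0/n≡0 n))))
    where m<n = ≰⇒> n≰m

  [r+q*n]/n : ∀ r q → r < n → (r + q * n) / n ≡ q
  [r+q*n]/n r q r<n = trans (+-distrib-/-∣ʳ r (n∣m*n q)) (cong₂ _+_ (m<n⇒m/n≡0 r<n) (m*n/n≡m q n))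

  /-suc : ∀ m → suc m / n ≡ χ (n ∣? suc m) + m / n
  /-suc m with n ∣? suc m
  ... | yes d@(divides (suc k) eq) = begin
      suc m / n                  ≡⟨ cong (_/ n) eq ⟩
      (suc k * n) / n            ≡⟨ m*n/n≡m (suc k) n ⟩
      -- The predecessor of `suc k * n` has remainder `n ∸ 1` and quotient `k`.
      suc k                      ≡⟨ cong suc (sym ([r+q*n]/n (n ∸ 1) k (≤-reflexive (suc-pred n)))) ⟩
      suc ((n ∸ 1 + k * n) / n)  ≡⟨ cong (λ z → suc (z / n)) (sym m≡) ⟩
      suc (m / n)                ∎
    where
    open ≡-Reasoning
    m≡ : m ≡ n ∸ 1 + k * n
    m≡ = suc-injective (trans eq (cong (_+ k * n) (sym (suc-pred n))))
  ... | no ∤ with suc m % n in r | m≡m%n+[m/n]*n (suc m) n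
  ...   | zero   | eq = contradiction (divides (suc m / n) eq) ∤
  ...   | suc r′ | eq = sym (trans (cong (_/ n) (suc-injective eq))
                          ([r+q*n]/n r′ (suc m / n) (<-trans (n<1+n r′) (subst (_< n) r (m%n<n (suc m) n)))))

  -- If `u` is a North label, these `c` are the non-negative labels of the squares to the right of
  -- that step, hence below the path.
  below? : ∀ u c → Dec (c < u × n ∣ u ∸ c)
  below? u c = (c <? u) ×-dec (n ∣? (u ∸ c))

  -- Summed over consecutive `c`, this turns the number of `c` in an interval that pass `below?`
  -- into a difference of two quotients.
  [u∸c]/n-step : ∀ u c → (u ∸ c) / n ≡ χ (below? u c) + (u ∸ suc c) / n
  [u∸c]/n-step u c with c <? u
  ... | yes c<u = begin
      (u ∸ c) / n                            ≡⟨ cong (_/ n) suc-∸ ⟩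
      suc (u ∸ suc c) / n                    ≡⟨ /-suc (u ∸ suc c) ⟩
      χ (n ∣? suc (u ∸ suc c)) + (u ∸ suc c) / n ≡⟨ cong (_+ (u ∸ suc c) / n) (χ-cong (n ∣? suc (u ∸ suc c)) (below? u c)
                                                   (λ d → c<u , subst (n ∣_) (sym suc-∸) d) (subst (n ∣_) suc-∸ ∘ proj₂)) ⟩
      χ (below? u c) + (u ∸ suc c) / n       ∎
    where
    open ≡-Reasoning
    suc-∸ : u ∸ c ≡ suc (u ∸ suc c)
    suc-∸ = +-∸-assoc 1 c<u
  ... | no c≮u = trans (cong (_/ n) (trans (m≤n⇒m∸n≡0 u≤c) (sym (m≤n⇒m∸n≡0 (≤-trans u≤c (n≤1+n c))))))
                       (cong (_+ (u ∸ suc c) / n) (sym (χ-no (below? u c) (c≮u ∘ proj₁))))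
    where u≤c = ≮⇒≥ c≮u

  %≡⇒∣∸ : ∀ m o → m % n ≡ o % n → n ∣ o ∸ m
  %≡⇒∣∸ m o eq = divides (o / n ∸ m / n) (begin
    o ∸ m ≡⟨ cong₂ _∸_ (m≡m%n+[m/n]*n o n) (trans (m≡m%n+[m/n]*n m n) (cong (_+ m / n * n) eq)) ⟩
    (o % n + o / n * n) ∸ (o % n + m / n * n) ≡⟨ [m+n]∸[m+o]≡n∸o (o % n) _ _ ⟩
    o / n * n ∸ m / n * n ≡⟨ sym (*-distribʳ-∸ n (o / n) (m / n)) ⟩
    (o / n ∸ m / n) * n ∎)
    where open ≡-Reasoning

  ∣∸⇒%≡ : ∀ {m o} → m ≤ o → n ∣ o ∸ m → m % n ≡ o % n
  ∣∸⇒%≡ {m} {o} m≤o d = trans (sym (%-remove-+ʳ m d)) (cong (_% n) (m+[n∸m]≡n m≤o))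

  ∣-∣⇒%≡ : ∀ h u → n ∣ ∣ ℤ.+ h ℤ.- ℤ.+ u ∣ → h % n ≡ u % n
  ∣-∣⇒%≡ h u d with ≤-total h u
  ... | inj₁ h≤u = ∣∸⇒%≡ h≤u (subst (n ∣_) (trans (cong ∣_∣ (ℤₚ.m-n≡m⊖n h u)) (ℤₚ.∣⊖∣-≤ h≤u)) d)
  ... | inj₂ u≤h = sym (∣∸⇒%≡ u≤h (subst (n ∣_) (cong ∣_∣ (trans (ℤₚ.m-n≡m⊖n h u) (ℤₚ.⊖-≥ u≤h))) d))

length-path : ∀ s → length s ≡ countN s + countE s
length-path []      = refl
length-path (N ∷ s) = cong suc (length-path s)
length-path (E ∷ s) = trans (cong suc (length-path s)) (sym (+-suc (countN s) (countE s)))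

-- Walks on labels and telescoping along them.

module Walks (n p : ℕ) {{_ : NonZero n}} where

  -- Labels are natural numbers, so demanding that an East step start at some `q + n` encodes
  -- staying weakly above the diagonal.
  data Walk : ℕ → List Step → ℕ → Set where
    done  : ∀ {v} → Walk v [] v
    north : ∀ {v s w} → Walk (v + p) s w → Walk v (N ∷ s) w
    east  : ∀ {q s w} → Walk q s w → Walk (q + n) (E ∷ s) w

  -- East steps are recorded by their ends, so that their starts `q + n` are obtained without
  -- subtraction.
  norths eastEnds : ∀ {v s w} → Walk v s w → List ℕ
  norths done              = []
  norths (north {v} W)     = v ∷ norths W
  norths (east W)          = norths W
  eastEnds done            = []
  eastEnds (north W)       = eastEnds W
  eastEnds (east {q} W)    = q ∷ eastEnds W

  length-norths : ∀ {v s w} (W : Walk v s w) → length (norths W) ≡ countN s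
  length-norths done      = refl
  length-norths (north W) = cong suc (length-norths W)
  length-norths (east W)  = length-norths W

  length-eastEnds : ∀ {v s w} (W : Walk v s w) → length (eastEnds W) ≡ countE s
  length-eastEnds done      = refl
  length-eastEnds (north W) = length-eastEnds W
  length-eastEnds (east W)  = cong suc (length-eastEnds W)

  -- Both sides sum `G` over all vertices: on the left over the ends of the steps and the initial
  -- vertex, on the right over the starts and the final vertex.
  telescope : (G : ℕ → ℕ) → ∀ {v s w} (W : Walk v s w) →
    S (λ u → G (u + p)) (norths W) + S G (eastEnds W) + G v ≡
    S G (norths W) + S (λ q → G (q + n)) (eastEnds W) + G w
  telescope G done = refl
  telescope G {v} {w = w} (north W) = begin
      G (v + p) + A + B + G v   ≡⟨ shuffle (G (v + p)) A B (G v) ⟩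
      G v + (A + B + G (v + p)) ≡⟨ cong (G v +_) (telescope G W) ⟩
      G v + (C + D + G w)       ≡⟨ reassoc (G v) C D (G w) ⟩
      G v + C + D + G w         ∎
    where
    open ≡-Reasoning
    A = S (λ u → G (u + p)) (norths W)
    B = S G (eastEnds W)
    C = S G (norths W)
    D = S (λ q → G (q + n)) (eastEnds W)
    shuffle : ∀ g a b h → g + a + b + h ≡ h + (a + b + g)
    shuffle = solve-∀
    reassoc : ∀ g a b h → g + (a + b + h) ≡ g + a + b + h
    reassoc = solve-∀
  telescope G {w = w} (east {q} W) = begin
      A + (G q + B) + G (q + n) ≡⟨ shuffle A (G q) B (G (q + n)) ⟩
      G (q + n) + (A + B + G q) ≡⟨ cong (G (q + n) +_) (telescope G W) ⟩
      G (q + n) + (C + D + G w) ≡⟨ reassoc (G (q + n)) C D (G w) ⟩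
      C + (G (q + n) + D) + G w ∎
    where
    open ≡-Reasoning
    A = S (λ u → G (u + p)) (norths W)
    B = S G (eastEnds W)
    C = S G (norths W)
    D = S (λ q → G (q + n)) (eastEnds W)
    shuffle : ∀ a g b h → a + (g + b) + h ≡ h + (a + b + g)
    shuffle = solve-∀
    reassoc : ∀ g c d h → g + (c + d + h) ≡ c + (g + d) + h
    reassoc = solve-∀

  telescope-closed : (G : ℕ → ℕ) → ∀ {v s} (W : Walk v s v) →
    S (λ u → G (u + p)) (norths W) + S G (eastEnds W) ≡ S G (norths W) + S (λ q → G (q + n)) (eastEnds W)
  telescope-closed G {v} W = +-cancelʳ-≡ (G v) _ _ (telescope G W)

  -- Telescope `(u ∸ c) / n`: an East step from `q + n` to `q` lowers it by one if `c ≤ q` and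
  -- leaves it at zero otherwise.
  row-telescope : ∀ {v s} (W : Walk v s v) c →
    S (λ u → (u + p ∸ c) / n) (norths W) ≡ S (λ q → χ (c ≤? q)) (eastEnds W) + S (λ u → (u ∸ c) / n) (norths W)
  row-telescope W c = +-cancelʳ-≡ (S G qs) _ _ (begin
      S (λ u → G (u + p)) ns + S G qs         ≡⟨ telescope-closed G W ⟩
      S G ns + S (λ q → G (q + n)) qs         ≡⟨ cong (S G ns +_) (trans (S-cong qs (λ q _ → G-east q)) (S-+ _ G qs)) ⟩
      S G ns + (S above qs + S G qs)          ≡⟨ sym (+-assoc (S G ns) _ _) ⟩
      S G ns + S above qs + S G qs            ≡⟨ cong (_+ S G qs) (+-comm (S G ns) _) ⟩
      S above qs + S G ns + S G qs            ∎)
    where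
    open ≡-Reasoning
    G above : ℕ → ℕ
    G u = (u ∸ c) / n
    above q = χ (c ≤? q)
    ns = norths W
    qs = eastEnds W
    to : ∀ q → n ≤ q + n ∸ c → c ≤ q
    to q le = +-cancelʳ-≤ n c q (subst (_≤ q + n) (+-comm n c) (m≤o∸n⇒m+n≤o n c≤q+n le))
      where
      -- Otherwise the truncated difference would be zero, below the positive `n`.
      c≤q+n : c ≤ q + n
      c≤q+n = <⇒≤ (m∸n≢0⇒n<m (λ eq → <⇒≱ (>-nonZero⁻¹ n) (subst (n ≤_) eq le)))
    from : ∀ q → c ≤ q → n ≤ q + n ∸ c
    from q c≤q = m+n≤o⇒m≤o∸n n (subst (_≤ q + n) (+-comm c n) (+-monoˡ-≤ n c≤q))
    cancel : ∀ q → (q + n ∸ c) ∸ n ≡ q ∸ c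
    cancel q = trans (∸-+-assoc (q + n) c n) ([m+n]∸[o+n] q c)
      where
      [m+n]∸[o+n] : ∀ m o → (m + n) ∸ (o + n) ≡ m ∸ o
      [m+n]∸[o+n] m o = trans (cong₂ _∸_ (+-comm m n) (+-comm o n)) ([m+n]∸[m+o]≡n∸o n m o)
    G-east : ∀ q → G (q + n) ≡ above q + G q
    G-east q = trans (/-step n (q + n ∸ c))
      (cong₂ _+_ (χ-cong (n ≤? (q + n ∸ c)) (c ≤? q) (to q) (from q)) (cong (_/ n) (cancel q)))

  -- Telescope `(u ∸ suc v) / n`, which decreases in `v`: an East step raises it by one exactly if
  -- its start lies below `u`. The `suc` makes this comparison strict.
  column-telescope : ∀ {v s} (W : Walk v s v) u →
    S (λ v → (u ∸ suc v) / n) (norths W) ≡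
    S (λ q → χ (q + n <? u)) (eastEnds W) + S (λ v → (u ∸ suc (v + p)) / n) (norths W)
  column-telescope W u = +-cancelʳ-≡ (S (λ q → G (q + n)) qs) _ _ (begin
      S G ns + S (λ q → G (q + n)) qs                       ≡⟨ sym (telescope-closed G W) ⟩
      S (λ v → G (v + p)) ns + S G qs                       ≡⟨ cong (A +_) (trans (S-cong qs (λ q _ → G-east q)) (S-+ before _ qs)) ⟩
      A + (S before qs + S (λ q → G (q + n)) qs)            ≡⟨ sym (+-assoc A _ _) ⟩
      A + S before qs + S (λ q → G (q + n)) qs              ≡⟨ cong (_+ S (λ q → G (q + n)) qs) (+-comm A _) ⟩
      S before qs + A + S (λ q → G (q + n)) qs              ∎)
    where
    open ≡-Reasoning
    G before : ℕ → ℕ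
    G v = (u ∸ suc v) / n
    before q = χ (q + n <? u)
    ns = norths W
    qs = eastEnds W
    A = S (λ v → G (v + p)) ns
    to : ∀ q → n ≤ u ∸ suc q → q + n < u
    to q le = subst (_≤ u) (trans (+-suc n q) (cong suc (+-comm n q))) (m≤o∸n⇒m+n≤o n q<u le)
      where
      q<u : q < u
      q<u = <⇒≤ (m∸n≢0⇒n<m (λ eq → <⇒≱ (>-nonZero⁻¹ n) (subst (n ≤_) eq le)))
    from : ∀ q → q + n < u → n ≤ u ∸ suc q
    from q lt = m+n≤o⇒m≤o∸n n (subst (_≤ u) (sym (trans (+-suc n q) (cong suc (+-comm n q)))) lt)
    G-east : ∀ q → G q ≡ before q + G (q + n)
    G-east q = trans (/-step n (u ∸ suc q))
      (cong₂ _+_ (χ-cong (n ≤? (u ∸ suc q)) (q + n <? u) (to q) (from q)) (cong (_/ n) (∸-+-assoc u (suc q) n)))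

  -- Following the path from a vertex, the first North step is reached by East steps only.
  next-north : ∀ {v s w} (W : Walk v s w) → ∃ λ u → u ∈ w ∷ norths W × ∃ λ k → v ≡ u + k * n
  next-north {v} done      = v , here refl , 0 , sym (+-identityʳ v)
  next-north {v} (north W) = v , there (here refl) , 0 , sym (+-identityʳ v)
  next-north (east {q} W) with next-north W
  ... | u , u∈ , k , eq = u , u∈ , suc k , trans (cong (_+ n) eq) (assoc u n (k * n))
    where
    assoc : ∀ a b c → a + c + b ≡ a + (b + c)
    assoc = solve-∀

  skip : ∀ {u v w : ℕ} {xs} → u ∈ w ∷ xs → u ∈ w ∷ v ∷ xs
  skip (here eq)  = here eq
  skip (there u∈) = there (there u∈)

  -- Only East steps separate the end `t + p` from the next North step; the final vertex `w` stands
  -- in when none follows.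
  next-after-north : ∀ {v s w t} (W : Walk v s w) → t ∈ norths W → ∃ λ u → u ∈ w ∷ norths W × ∃ λ k → t + p ≡ u + k * n
  next-after-north (north W) (here refl) with next-north W
  ... | u , u∈ , k = u , skip u∈ , k
  next-after-north (north W) (there t∈) with next-after-north W t∈
  ... | u , u∈ , k = u , skip u∈ , k
  next-after-north (east W) t∈ = next-after-north W t∈

  next-after-east : ∀ {v s w q} (W : Walk v s w) → q ∈ eastEnds W → ∃ λ u → u ∈ w ∷ norths W × ∃ λ k → q ≡ u + k * n
  next-after-east (north W) q∈ with next-after-east W q∈
  ... | u , u∈ , k = u , skip u∈ , k
  next-after-east (east W) (here refl) = next-north W
  next-after-east (east W) (there q∈) = next-after-east W q∈

  -- An East step starts at a label of at least `n`, so a nonempty walk from 0 begins with a North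
  -- step.
  0∈norths : ∀ {v s} (W : Walk v s 0) → v ≡ 0 → 1 ≤ countN s → 0 ∈ norths W
  0∈norths (north W)    refl _ = here refl
  0∈norths (east {q} W) eq   _ = contradiction (m+n≡0⇒n≡0 q eq) (≢-nonZero⁻¹ n)

  -- Lattice points and their labels.

  -- The equation `n * i + v ≡ p * j` is the subtraction-free way, used from here on, to say that
  -- `(i , j)` has label `v`.
  label≡ : ∀ {i j v} → n * i + v ≡ p * j → label n p i j ≡ ℤ.+ v
  label≡ {i} {j} {v} eq = begin
      ℤ.+ (j * p) ℤ.- ℤ.+ (i * n) ≡⟨ cong (λ z → ℤ.+ z ℤ.- ℤ.+ (i * n)) jp≡ ⟩
      ℤ.+ (v + i * n) ℤ.- ℤ.+ (i * n) ≡⟨ ℤₚ.m-n≡m⊖n (v + i * n) (i * n) ⟩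
      (v + i * n) ⊖ (i * n) ≡⟨ ℤₚ.⊖-≥ (m≤n+m (i * n) v) ⟩
      ℤ.+ (v + i * n ∸ i * n) ≡⟨ cong ℤ.+_ (m+n∸n≡m v (i * n)) ⟩
      ℤ.+ v ∎
    where
    open ≡-Reasoning
    jp≡ : j * p ≡ v + i * n
    jp≡ = trans (*-comm j p) (trans (sym eq) (trans (+-comm (n * i) v) (cong (v +_) (*-comm n i))))

  label-inverse : ∀ {h i j} → ℤ.+ h ≡ label n p i j → n * i + h ≡ p * j
  label-inverse {h} {i} {j} eq = trans (+-comm (n * i) h) (trans (cong (h +_) (*-comm n i)) (trans (ℤₚ.+-injective (begin
    ℤ.+ h ℤ.+ b             ≡⟨ cong (ℤ._+ b) eq ⟩
    (ℤ.+ (j * p) ℤ.- b) ℤ.+ b ≡⟨ ℤₚ.+-assoc (ℤ.+ (j * p)) (ℤ.- b) b ⟩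
    ℤ.+ (j * p) ℤ.+ (ℤ.- b ℤ.+ b) ≡⟨ cong (ℤ._+_ (ℤ.+ (j * p))) (ℤₚ.+-inverseˡ b) ⟩
    ℤ.+ (j * p) ℤ.+ ℤ.0ℤ    ≡⟨ ℤₚ.+-identityʳ _ ⟩
    ℤ.+ (j * p)             ∎)) (*-comm j p)))
    where
    open ≡-Reasoning
    b = ℤ.+ (i * n)

  -- Relates a North step in column `e` with label `h + suc k * n` to the square with label `h`
  -- whose bottom-right corner is `suc k` columns further right.
  shift-east : ∀ e k h → n * e + (h + suc k * n) ≡ n * suc (e + k) + h
  shift-east e k h = go n e k h
    where
    go : ∀ n e k h → n * e + (h + suc k * n) ≡ n * suc (e + k) + h
    go = solve-∀

  point-north : ∀ {i j v} → n * i + v ≡ p * j → n * i + (v + p) ≡ p * suc j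
  point-north {i} {j} {v} eq = trans (sym (+-assoc (n * i) v p)) (trans (cong (_+ p) eq) (trans (+-comm (p * j) p) (sym (*-suc p j))))

  point-east : ∀ {i j q} → n * i + (q + n) ≡ p * j → n * suc i + q ≡ p * j
  point-east {i} {j} {q} eq = trans (cong (_+ q) (*-suc n i)) (trans (shuffle n (n * i) q) eq)
    where
    shuffle : ∀ a b c → a + b + c ≡ b + (c + a)
    shuffle = solve-∀

  north-labels : ∀ {f : ℕ × ℕ → ℤ} → (∀ i j → f (i , j) ≡ label n p i j) →
    ∀ {i j v s w} (W : Walk v s w) → n * i + v ≡ p * j →
    map f (northStartsFrom i j s) ≡ map ℤ.+_ (norths W)
  north-labels f≡ done      eq = refl
  north-labels f≡ (north W) eq = cong₂ _∷_ (trans (f≡ _ _) (label≡ eq)) (north-labels f≡ W (point-north eq))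
  north-labels f≡ (east W)  eq = north-labels f≡ W (point-east eq)

  start-norths : ∀ {i j v s w e y} (W : Walk v s w) → n * i + v ≡ p * j →
    (e , y) ∈ northStartsFrom i j s → ∃ λ u → u ∈ norths W × n * e + u ≡ p * y
  start-norths {v = v} (north W) eq (here refl) = v , here refl , eq
  start-norths (north W) eq (there ∈s) with start-norths W (point-north eq) ∈s
  ... | u , u∈ , eq′ = u , there u∈ , eq′
  start-norths (east W)  eq ∈s = start-norths W (point-east eq) ∈s

  -- The bounds on the row `y` separate the residues of successive North steps and later keep
  -- squares inside the rectangle.
  norths-starts : ∀ {i j v s w u} (W : Walk v s w) → n * i + v ≡ p * j → u ∈ norths W →
    ∃ λ e → ∃ λ y → (e , y) ∈ northStartsFrom i j s × n * e + u ≡ p * y × j ≤ y × y < j + countN s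
  norths-starts {i} {j} {s = N ∷ s} (north W) eq (here refl) =
    i , j , here refl , eq , ≤-refl , m<m+n j (s≤s z≤n)
  norths-starts {j = j} {s = N ∷ s} (north W) eq (there u∈) with norths-starts W (point-north eq) u∈
  ... | e , y , ∈s , eq′ , j<y , y<n = e , y , there ∈s , eq′ , <⇒≤ j<y , subst (y <_) (sym (+-suc j (countN s))) y<n
  norths-starts (east W) eq u∈ = norths-starts W (point-east eq) u∈

  row-residue : ∀ {e y u} → n * e + u ≡ p * y → (p * y) % n ≡ u % n
  row-residue {e} {u = u} eq = trans (cong (_% n) (sym eq)) (%-remove-+ˡ u (m∣m*n e))

  -- Modulo `n` a North label is `p` times its row. Two rows differ by less than `n`, and `p` can be
  -- cancelled by coprimality.
  norths-residues : Coprime n p → ∀ {i j v s w} (W : Walk v s w) → n * i + v ≡ p * j → j + countN s ≤ n →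
    AllPairs (λ u u′ → u % n ≢ u′ % n) (norths W)
  norths-residues cop done _ _ = []
  norths-residues cop (east W) eq le = norths-residues cop W (point-east eq) le
  norths-residues cop {i} {j} {v} {N ∷ s} (north W) eq le =
      All.tabulate distinct ∷ norths-residues cop W (point-north eq) le′
    where
    le′ : suc j + countN s ≤ n
    le′ = subst (_≤ n) (+-suc j (countN s)) le
    distinct : ∀ {u} → u ∈ norths W → v % n ≢ u % n
    distinct {u} u∈ same with norths-starts W (point-north eq) u∈
    ... | e , y , _ , eq′ , j<y , y<m = <⇒≱ y∸j<n (∣⇒≤ {{>-nonZero (m<n⇒0<n∸m j<y)}} n∣y∸j)
      where
      n∣y∸j : n ∣ y ∸ j
      n∣y∸j = coprime-divisor cop (subst (n ∣_) (sym (*-distribˡ-∸ p y j))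
        (%≡⇒∣∸ n (p * j) (p * y) (trans (row-residue eq) (trans same (sym (row-residue eq′))))))
      y∸j<n : y ∸ j < n
      y∸j<n = ≤-<-trans (m∸n≤m y j) (<-≤-trans y<m le′)

  -- The Dyck condition at the end of an East step makes the label there a natural number `q`; at
  -- the corner `(p , n)` the label is 0.
  mkWalk : ∀ {P : ℕ × ℕ → Set} → (∀ {i j} → P (i , j) → n * i ≤ p * j) →
    ∀ s {i j v} → All P (pointsFrom i j s) → n * i + v ≡ p * j → i + countE s ≡ p → j + countN s ≡ n → Walk v s 0
  mkWalk above [] {i} {j} {v} _ eq i≡p j≡n = subst (λ z → Walk z [] 0) (sym v≡0) done
    where
    v≡0 : v ≡ 0
    v≡0 = +-cancelˡ-≡ (n * i) v 0 (trans eq (trans (cong₂ _*_ (sym (trans (sym (+-identityʳ i)) i≡p)) (trans (sym (+-identityʳ j)) j≡n))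
      (trans (*-comm i n) (sym (+-identityʳ (n * i))))))
  mkWalk above (N ∷ s) {i} {j} (_ ∷ ps) eq i≡p j≡n =
    north (mkWalk above s ps (point-north eq) i≡p (trans (sym (+-suc j (countN s))) j≡n))
  mkWalk above (E ∷ s) {i} {j} {v} (_ ∷ ps) eq i≡p j≡n =
      subst (λ z → Walk z (E ∷ s) 0) (sym v≡) (east (mkWalk above s ps eq′ (trans (sym (+-suc i (countE s))) i≡p) j≡n))
    where
    first : ∀ {P : ℕ × ℕ → Set} {i j} s → All P (pointsFrom i j s) → P (i , j)
    first []      (h ∷ _) = h
    first (N ∷ _) (h ∷ _) = h
    first (E ∷ _) (h ∷ _) = h
    q = p * j ∸ n * suc i
    eq′ : n * suc i + q ≡ p * j
    eq′ = m+[n∸m]≡n (above (first s ps))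
    shuffle : ∀ a b c → a + b + c ≡ b + (c + a)
    shuffle = solve-∀
    v≡ : v ≡ q + n
    v≡ = +-cancelˡ-≡ (n * i) v (q + n) (trans eq (trans (sym eq′) (trans (cong (_+ q) (*-suc n i)) (shuffle n (n * i) q))))

-- Indexing into lists.

nthOr-∈ : ∀ d l {k} → k < length l → nthOr d l k ∈ l
nthOr-∈ d (a ∷ l) {zero}  _         = here refl
nthOr-∈ d (a ∷ l) {suc k} (s≤s k<l) = there (nthOr-∈ d l k<l)

map-nthOr : ∀ d l → map (nthOr d l) (upTo (length l)) ≡ l
map-nthOr d l = trans (map-upTo _ (length l)) (go l)
  where
  go : ∀ l → applyUpTo (nthOr d l) (length l) ≡ l
  go []      = refl
  go (a ∷ l) = cong (a ∷_) (go l)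

nthOr-AllPairs : ∀ {R : ℤ → ℤ → Set} d {l} → AllPairs R l → ∀ {i j} → i < j → j < length l → R (nthOr d l i) (nthOr d l j)
nthOr-AllPairs d (r ∷ _)  {zero}  {suc j} _         (s≤s j<l) = All.lookup r (nthOr-∈ d _ j<l)
nthOr-AllPairs d (_ ∷ rs) {suc i} {suc j} (s≤s i<j) (s≤s j<l) = nthOr-AllPairs d rs i<j j<l

AllPairs-∈ : ∀ {A : Set} {f : A → ℕ} {xs} → AllPairs (λ x y → f x ≢ f y) xs → ∀ {x y} → x ∈ xs → y ∈ xs → f x ≡ f y → x ≡ y
AllPairs-∈ (r ∷ _)  (here refl) (here refl) _  = refl
AllPairs-∈ (r ∷ _)  (here refl) (there y∈)  eq = contradiction eq (All.lookup r y∈)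
AllPairs-∈ (r ∷ _)  (there x∈)  (here refl) eq = contradiction (sym eq) (All.lookup r x∈)
AllPairs-∈ (_ ∷ rs) (there x∈)  (there y∈)  eq = AllPairs-∈ rs x∈ y∈ eq

-- North labels of a Dyck path and their residues.

module Paths (n p : ℕ) {{_ : NonZero n}} {{_ : NonZero p}} (cop : Coprime n p) where

  open Walks n p

  origin : n * 0 + 0 ≡ p * 0
  origin = trans (+-identityʳ (n * 0)) (trans (*-zeroʳ n) (sym (*-zeroʳ p)))

  walk : (x : DyckPath n p) → Walk 0 (path x) 0
  walk x = mkWalk id (path x) (aboveDiag x) origin (numE x) (numN x)

  ns qs : DyckPath n p → List ℕ
  ns x = norths (walk x)
  qs x = eastEnds (walk x)

  module _ (x : DyckPath n p) where

    ns-residues : AllPairs (λ u v → u % n ≢ v % n) (ns x)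
    ns-residues = norths-residues cop (walk x) origin (≤-reflexive (numN x))

    ns-residue-injective : ∀ {u v} → u ∈ ns x → v ∈ ns x → u % n ≡ v % n → u ≡ v
    ns-residue-injective = AllPairs-∈ ns-residues

    0∈ns : 0 ∈ ns x
    0∈ns = 0∈norths (walk x) refl (subst (1 ≤_) (sym (numN x)) (>-nonZero⁻¹ n))

    -- The path ends at the label of its first North step, so the final vertex is no exception when
    -- the next North step is sought cyclically.
    ∈-0∷ns : ∀ {u} → u ∈ 0 ∷ ns x → u ∈ ns x
    ∈-0∷ns (here refl) = 0∈ns
    ∈-0∷ns (there u∈)  = u∈

    -- The next North step after `t`, cyclically, has a label of at most `t + p` with the residue of
    -- `t + p`. Residues determine North labels, so this label is `u`.
    ns-+p : ∀ {t u} → t ∈ ns x → u ∈ ns x → (t + p) % n ≡ u % n → u ≤ t + p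
    ns-+p {t} {u} t∈ u∈ eq with next-after-north (walk x) t∈
    ... | w , w∈ , k , t+p≡ = subst₂ _≤_ w≡u (sym t+p≡) (m≤m+n w (k * n))
      where
      w≡u : w ≡ u
      w≡u = ns-residue-injective (∈-0∷ns w∈) u∈ (trans (sym ([m+kn]%n≡m%n w k n)) (trans (cong (_% n) (sym t+p≡)) eq))

    -- Otherwise the first North step after that East step has the same residue and a smaller label.
    east-start∉ns : ∀ {q} → q ∈ qs x → ¬ q + n ∈ ns x
    east-start∉ns {q} q∈ q+n∈ with next-after-east (walk x) q∈
    ... | w , w∈ , k , q≡ = <⇒≢ w<q+n (ns-residue-injective (∈-0∷ns w∈) q+n∈ (sym same))
      where
      w<q+n : w < q + n
      w<q+n = ≤-<-trans (subst (w ≤_) (sym q≡) (m≤m+n w (k * n))) (m<m+n q (>-nonZero⁻¹ n))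
      same : (q + n) % n ≡ w % n
      same = trans ([m+n]%n≡m%n q n) (trans (cong (_% n) q≡) ([m+kn]%n≡m%n w k n))

    -- Squares below the path and tableau entries.

    belowLabels⁻ : ∀ {h} → ℤ.+ h ∈ belowLabels n p (path x) → ∃ λ v → v ∈ ns x × ∃ λ k → v ≡ h + suc k * n
    belowLabels⁻ {h} h∈ with find (∈-concatMap⁻ _ {xs = northStarts (path x)} h∈)
    ... | (e , y) , ∈s , h∈row with ∈-map⁻ _ h∈row | start-norths (walk x) origin ∈s
    ...   | k , _ , h≡ | v , v∈ , v≡ = v , v∈ , k , +-cancelˡ-≡ (n * e) _ _
            (trans v≡ (trans (sym (label-inverse h≡)) (sym (shift-east e k h))))

    belowLabels⁺ : ∀ {h} → ∀ k → h + suc k * n ∈ ns x → ℤ.+ h ∈ belowLabels n p (path x)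
    belowLabels⁺ {h} k u∈ with norths-starts (walk x) origin u∈
    ... | e , y , ∈s , u≡ , _ , y<n = ∈-concatMap⁺ _ (lose ∈s
            (subst (_∈ row) (label≡ point) (∈-map⁺ (λ k → label n p (suc (e + k)) y) (∈-upTo⁺ k<p∸e))))
      where
      open ≤-Reasoning
      row = map (λ k → label n p (suc (e + k)) y) (upTo (p ∸ e))
      point : n * suc (e + k) + h ≡ p * y
      point = trans (sym (shift-east e k h)) u≡
      -- As `h` is non-negative and `y < n`, the corner of the square lies in a column of the
      -- rectangle.
      column≤p : suc (e + k) ≤ p
      column≤p = *-cancelˡ-≤ n (begin
        n * suc (e + k)     ≤⟨ m≤m+n _ h ⟩
        n * suc (e + k) + h ≡⟨ point ⟩
        p * y               ≤⟨ *-monoʳ-≤ p (<⇒≤ (subst (y <_) (numN x) y<n)) ⟩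
        p * n               ≡⟨ *-comm p n ⟩
        n * p               ∎)
      k<p∸e : k < p ∸ e
      k<p∸e = m+n≤o⇒m≤o∸n (suc k) (subst (_≤ p) (cong suc (+-comm e k)) column≤p)

    -- A label below the path lies a positive multiple of `n` under some North label; the congruence
    -- forces that North label to be `u`.
    codinv-test⁻ : ∀ {h u} → u ∈ ns x →
      T (inH n p x (ℤ.+ h) ∧ ⌊ n ∣? ∣ ℤ.+ h ℤ.- ℤ.+ u ∣ ⌋) → h < u × n ∣ u ∸ h
    codinv-test⁻ {h} {u} u∈ t with Equivalence.to T-∧ t
    ... | tH , t∣ with find (any⁻ _ (belowLabels n p (path x)) (proj₂ (Equivalence.to (T-∧ {⌊ ℤ.0ℤ ℤ.<? ℤ.+ h ⌋}) tH)))
    ...   | h′ , h′∈ , h≟h′ with belowLabels⁻ (subst (_∈ belowLabels n p (path x)) (sym (toWitness h≟h′)) h′∈)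
    ...     | v , v∈ , k , v≡ = subst (h <_) h+≡u (m<m+n h (<-≤-trans (>-nonZero⁻¹ n) (m≤m+n n (k * n)))) ,
                divides (suc k) (trans (cong (_∸ h) (sym h+≡u)) (m+n∸m≡n h (suc k * n)))
      where
      h+≡u : h + suc k * n ≡ u
      h+≡u = trans (sym v≡) (ns-residue-injective v∈ u∈ (trans (cong (_% n) v≡)
        (trans ([m+kn]%n≡m%n h (suc k) n) (∣-∣⇒%≡ n h u (toWitness t∣)))))

    codinv-test⁺ : ∀ {h u} → u ∈ ns x → 0 < h → h < u × n ∣ u ∸ h →
      T (inH n p x (ℤ.+ h) ∧ ⌊ n ∣? ∣ ℤ.+ h ℤ.- ℤ.+ u ∣ ⌋)
    codinv-test⁺ {h} {u} u∈ 0<h (h<u , divides zero eq) = contradiction (m∸n≡0⇒m≤n eq) (<⇒≱ h<u)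
    codinv-test⁺ {h} {u} u∈ 0<h (h<u , d@(divides (suc k) eq)) =
      Equivalence.from (T-∧ {inH n p x (ℤ.+ h)}) (Equivalence.from (T-∧ {⌊ ℤ.0ℤ ℤ.<? ℤ.+ h ⌋}) (positive , below) , congruent)
      where
      u≡ : u ≡ h + suc k * n
      u≡ = trans (sym (m+[n∸m]≡n (<⇒≤ h<u))) (cong (h +_) eq)
      positive : T ⌊ ℤ.0ℤ ℤ.<? ℤ.+ h ⌋
      positive = fromWitness {a? = ℤ.0ℤ ℤ.<? ℤ.+ h} (ℤ.+<+ 0<h)
      below : T (any (λ h′ → ⌊ ℤ.+ h ℤₚ.≟ h′ ⌋) (belowLabels n p (path x)))
      below = any⁺ _ (Any.map (λ {h′} → fromWitness {a? = ℤ.+ h ℤₚ.≟ h′}) (belowLabels⁺ k (subst (_∈ ns x) u≡ u∈)))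
      congruent : T ⌊ n ∣? ∣ ℤ.+ h ℤ.- ℤ.+ u ∣ ⌋
      congruent = fromWitness {a? = n ∣? ∣ ℤ.+ h ℤ.- ℤ.+ u ∣}
        (subst (n ∣_) (sym (trans (cong ∣_∣ (ℤₚ.m-n≡m⊖n h u)) (ℤₚ.∣⊖∣-≤ (<⇒≤ h<u)))) d)

    codinv-count : ∀ {i j t u} → ℓ n p x i ≡ ℤ.+ t → ℓ n p x j ≡ ℤ.+ u → u ∈ ns x →
      codinv n p x i j ≡ S (λ k → χ (below? n u (suc t + k))) (upTo (p ∸ 1))
    codinv-count {i} {j} {t} {u} ℓi ℓj u∈ rewrite ℓi | ℓj =
      trans (length-filter-S _ (map (λ k → ℤ.+ t ℤ.+ ℤ.+ suc k) (upTo (p ∸ 1))))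
      (trans (S-map _ _ (upTo (p ∸ 1)))
      (S-cong (upTo (p ∸ 1)) λ k _ → trans
        (χ-cong (T? _) (below? n u (t + suc k)) (codinv-test⁻ u∈) (codinv-test⁺ u∈ (<-≤-trans (s≤s z≤n) (m≤n+m (suc k) t))))
        (cong (λ z → χ (below? n u z)) (+-suc t k))))

    -- As `c` runs from `suc t` to `t + p`, the quotient `(u ∸ c) / n` drops by one at each `c` that
    -- passes `below?`, and the tableau entry counts these drops.
    window : ∀ {i j t u} → ℓ n p x i ≡ ℤ.+ t → ℓ n p x j ≡ ℤ.+ u → u ∈ ns x →
      (u ∸ suc t) / n ≡ codinv n p x i j + (u ∸ (t + p)) / n
    window {i} {j} {t} {u} ℓi ℓj u∈ = begin
        (u ∸ suc t) / n                          ≡⟨ cong (λ z → (u ∸ suc z) / n) (sym (+-identityʳ t)) ⟩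
        F 0                                      ≡⟨ S-telescope _ F F-step (p ∸ 1) ⟩
        S (λ k → χ (below? n u (suc t + k))) (upTo (p ∸ 1)) + F (p ∸ 1)
          ≡⟨ cong₂ (λ a c → a + (u ∸ c) / n) (sym (codinv-count {i} {j} ℓi ℓj u∈)) (trans (sym (+-suc t (p ∸ 1))) (cong (t +_) (suc-pred p))) ⟩
        codinv n p x i j + (u ∸ (t + p)) / n     ∎
      where
      open ≡-Reasoning
      F : ℕ → ℕ
      F k = (u ∸ (suc t + k)) / n
      F-step : ∀ k → F k ≡ χ (below? n u (suc t + k)) + F (suc k)
      F-step k = trans ([u∸c]/n-step n u (suc t + k))
        (cong (λ z → χ (below? n u (suc t + k)) + (u ∸ z) / n) (sym (+-suc (suc t) k)))

    -- Neither endpoint of the window [ℓᵢ , ℓᵢ + p] is counted: both lie in the semimodule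
    -- generated by the North labels, while labels below the path do not.
    window-left : ∀ {t u} → t ∈ ns x → u ∈ ns x → (u ∸ t) / n ≡ (u ∸ suc t) / n
    window-left {t} {u} t∈ u∈ = trans ([u∸c]/n-step n u t) (cong (_+ (u ∸ suc t) / n)
      (χ-no (below? n u t) λ (t<u , d) → <⇒≢ t<u (ns-residue-injective t∈ u∈ (∣∸⇒%≡ n (<⇒≤ t<u) d))))

    window-right : ∀ {t u} → t ∈ ns x → u ∈ ns x → (u ∸ (t + p)) / n ≡ (u ∸ suc (t + p)) / n
    window-right {t} {u} t∈ u∈ = trans ([u∸c]/n-step n u (t + p)) (cong (_+ (u ∸ suc (t + p)) / n)
      (χ-no (below? n u (t + p)) λ (t+p<u , d) → <⇒≱ t+p<u (ns-+p t∈ u∈ (∣∸⇒%≡ n (<⇒≤ t+p<u) d))))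

    -- The sorted list of North labels.

    labels-↭ : northLabels n p x ↭ map ℤ.+_ (ns x)
    labels-↭ = ↭-trans (sort-↭ _) (↭-reflexive (north-labels (λ _ _ → refl) (walk x) origin))

    length-ns : length (ns x) ≡ n
    length-ns = trans (length-norths (walk x)) (numN x)

    length-labels : length (northLabels n p x) ≡ n
    length-labels = trans (↭-length labels-↭) (trans (length-map ℤ.+_ (ns x)) length-ns)

    -- 0-based: a k is the paper's ℓ_{k+1}.
    a : ℕ → ℕ
    a k = ∣ nthOr (ℤ.+ 0) (northLabels n p x) k ∣

    a-↭ : map a (upTo n) ↭ ns x
    a-↭ = ↭-trans (↭-reflexive a≡) (↭-trans (map⁺ ∣_∣ labels-↭) (↭-reflexive (trans (sym (map-∘ (ns x))) (map-id (ns x)))))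
      where
      a≡ : map a (upTo n) ≡ map ∣_∣ (northLabels n p x)
      a≡ = trans (map-∘ (upTo n)) (cong (map ∣_∣)
        (trans (cong (λ m → map (nthOr (ℤ.+ 0) (northLabels n p x)) (upTo m)) (sym length-labels)) (map-nthOr _ (northLabels n p x))))

    a∈ns : ∀ {k} → k < n → a k ∈ ns x
    a∈ns k<n = ∈-resp-↭ a-↭ (∈-map⁺ a (∈-upTo⁺ k<n))

    ns⇒a : ∀ {v} → v ∈ ns x → ∃ λ k → k < n × v ≡ a k
    ns⇒a v∈ with ∈-map⁻ a (∈-resp-↭ (↭-sym a-↭) v∈)
    ... | k , k∈ , eq = k , ∈-upTo⁻ k∈ , eq

    -- North labels are non-negative, so the absolute value in `a` loses nothing.
    ℓ≡a : ∀ {k} → k < n → ℓ n p x (suc k) ≡ ℤ.+ a k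
    ℓ≡a {k} k<n with ∈-map⁻ ℤ.+_ (∈-resp-↭ labels-↭ (nthOr-∈ (ℤ.+ 0) _ (subst (k <_) (sym length-labels) k<n)))
    ... | v , _ , eq = trans eq (cong (ℤ.+_ ∘ ∣_∣) (sym eq))

    -- Sorting gives weak monotonicity; distinct residues make it strict.
    a-strict : ∀ {i j} → i < j → j < n → a i < a j
    a-strict {i} {j} i<j j<n = ≤∧≢⇒< a≤ a≢
      where
      j<len = subst (j <_) (sym length-labels) j<n
      a≤ : a i ≤ a j
      a≤ = ℤₚ.drop‿+≤+ (subst₂ ℤ._≤_ (ℓ≡a (<-trans i<j j<n)) (ℓ≡a j<n)
        (nthOr-AllPairs (ℤ.+ 0) (Linked⇒AllPairs ℤₚ.≤-trans (sort-↗ _)) i<j j<len))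
      distinct : AllPairs _≢_ (northLabels n p x)
      distinct = PermS.Unique-resp-↭ (setoid ℤ) (↭⇒↭ₛ (↭-sym labels-↭))
        (AllPairsₚ.map⁺ (AllPairs.map (λ r eq → r (cong (_% n) (ℤₚ.+-injective eq))) ns-residues))
      a≢ : a i ≢ a j
      a≢ eq = nthOr-AllPairs (ℤ.+ 0) distinct i<j j<len
        (trans (ℓ≡a (<-trans i<j j<n)) (trans (cong ℤ.+_ eq) (sym (ℓ≡a j<n))))

    a-cancel-< : ∀ {i j} → i < n → a i < a j → i < j
    a-cancel-< {i} {j} i<n ai<aj with <-cmp i j
    ... | tri< i<j _ _    = i<j
    ... | tri≈ _ refl _   = contradiction ai<aj (<-irrefl refl)
    ... | tri> _ _ j<i    = contradiction ai<aj (<-asym (a-strict j<i i<n))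

    -- Row and column sums of the tableau.

    S-ns : (f : ℕ → ℕ) → S f (ns x) ≡ S (f ∘ a) (upTo n)
    S-ns f = trans (sym (S-↭ f a-↭)) (S-map f a (upTo n))

    -- The tableau with 0-based indices, extended by zero so that all rows and columns run over the
    -- same range.
    D : ℕ → ℕ → ℕ
    D i j = χ (i <? j) * codinv n p x (suc i) (suc j)

    -- For `i ≥ j` we have `a j ≤ a i`, so both quotients vanish along with the entry.
    D-window : ∀ {i j} → i < n → j < n → (a j ∸ suc (a i)) / n ≡ D i j + (a j ∸ (a i + p)) / n
    D-window {i} {j} i<n j<n with i <? j
    ... | yes i<j = trans (window {suc i} {suc j} (ℓ≡a i<n) (ℓ≡a j<n) (a∈ns j<n)) (cong (_+ (a j ∸ (a i + p)) / n) (sym (begin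
          χ (i <? j) * d ≡⟨ cong (_* d) (χ-yes (i <? j) i<j) ⟩
          1 * d          ≡⟨ *-identityˡ d ⟩
          d              ∎)))
      where
      open ≡-Reasoning
      d = codinv n p x (suc i) (suc j)
    ... | no i≮j = trans (cong (_/ n) (trans (m≤n⇒m∸n≡0 (≤-trans aj≤ai (n≤1+n _))) (sym (m≤n⇒m∸n≡0 (≤-trans aj≤ai (m≤m+n _ p))))))
                     (cong (λ z → z * codinv n p x (suc i) (suc j) + (a j ∸ (a i + p)) / n) (sym (χ-no (i <? j) i≮j)))
      where
      aj≤ai : a j ≤ a i
      aj≤ai = ≮⇒≥ (i≮j ∘ a-cancel-< i<n)

    -- Both quotients now have the same shape, with `a i` shifted by `p`, as telescoping requires.
    -- The closed form leads to weak comparisons, the open one to strict ones.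
    D-window-closed : ∀ {i j} → i < n → j < n → (a j ∸ a i) / n ≡ D i j + (a j ∸ (a i + p)) / n
    D-window-closed i<n j<n = trans (window-left (a∈ns i<n) (a∈ns j<n)) (D-window i<n j<n)

    D-window-open : ∀ {i j} → i < n → j < n → (a j ∸ suc (a i)) / n ≡ D i j + (a j ∸ suc (a i + p)) / n
    D-window-open {i} {j} i<n j<n = trans (D-window i<n j<n) (cong (D i j +_) (window-right (a∈ns i<n) (a∈ns j<n)))

    -- Summing the window identity over a row gives `row-telescope` up to a common term. The
    -- threshold `c` will be `a i + p` or its successor.
    row-sum : ∀ i c → (∀ {j} → j < n → (a j + p ∸ c) / n ≡ D i j + (a j ∸ c) / n) →
      S (D i) (upTo n) ≡ S (λ q → χ (c ≤? q)) (qs x)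
    row-sum i c eq = +-cancelʳ-≡ (S (λ j → (a j ∸ c) / n) (upTo n)) _ _ (begin
      S (D i) (upTo n) + S (λ j → (a j ∸ c) / n) (upTo n)   ≡⟨ sym (S-+ (D i) _ (upTo n)) ⟩
      S (λ j → D i j + (a j ∸ c) / n) (upTo n)              ≡⟨ S-cong (upTo n) (λ j j∈ → sym (eq (∈-upTo⁻ j∈))) ⟩
      S (λ j → (a j + p ∸ c) / n) (upTo n)                  ≡⟨ sym (S-ns (λ u → (u + p ∸ c) / n)) ⟩
      S (λ u → (u + p ∸ c) / n) (ns x)                      ≡⟨ row-telescope (walk x) c ⟩
      S (λ q → χ (c ≤? q)) (qs x) + S (λ u → (u ∸ c) / n) (ns x)
        ≡⟨ cong (S (λ q → χ (c ≤? q)) (qs x) +_) (S-ns (λ u → (u ∸ c) / n)) ⟩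
      S (λ q → χ (c ≤? q)) (qs x) + S (λ j → (a j ∸ c) / n) (upTo n) ∎)
      where open ≡-Reasoning

    row-sum-≥ : ∀ {i} → i < n → S (D i) (upTo n) ≡ S (λ q → χ (a i + p ≤? q)) (qs x)
    row-sum-≥ {i} i<n = row-sum i (a i + p) λ {j} j<n →
      trans (cong (_/ n) (trans (cong₂ _∸_ (+-comm (a j) p) (+-comm (a i) p)) ([m+n]∸[m+o]≡n∸o p (a j) (a i)))) (D-window-closed i<n j<n)

    -- The same value as in `row-sum-≥`: no East step ends where a North step ends.
    row-sum-> : ∀ {i} → i < n → S (D i) (upTo n) ≡ S (λ q → χ (suc (a i + p) ≤? q)) (qs x)
    row-sum-> {i} i<n = row-sum i (suc (a i + p)) λ {j} j<n →
      trans (cong (_/ n) (trans (cong₂ _∸_ (+-comm (a j) p) (+-comm (suc (a i)) p)) ([m+n]∸[m+o]≡n∸o p (a j) (suc (a i))))) (D-window-open i<n j<n)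

    -- The open window identity summed over a column is `column-telescope` at `a j`, up to a common
    -- term.
    column-sum : ∀ {j} → j < n → S (λ i → D i j) (upTo n) ≡ S (λ q → χ (q + n <? a j)) (qs x)
    column-sum {j} j<n = +-cancelʳ-≡ rest _ _ (begin
      S (λ i → D i j) (upTo n) + rest                       ≡⟨ sym (S-+ (λ i → D i j) _ (upTo n)) ⟩
      S (λ i → D i j + (a j ∸ suc (a i + p)) / n) (upTo n)  ≡⟨ S-cong (upTo n) (λ i i∈ → sym (D-window-open (∈-upTo⁻ i∈) j<n)) ⟩
      S (λ i → (a j ∸ suc (a i)) / n) (upTo n)              ≡⟨ sym (S-ns (λ v → (a j ∸ suc v) / n)) ⟩
      S (λ v → (a j ∸ suc v) / n) (ns x)                    ≡⟨ column-telescope (walk x) (a j) ⟩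
      C + S (λ v → (a j ∸ suc (v + p)) / n) (ns x)          ≡⟨ cong (C +_) (S-ns (λ v → (a j ∸ suc (v + p)) / n)) ⟩
      C + rest                                              ∎)
      where
      open ≡-Reasoning
      rest = S (λ i → (a j ∸ suc (a i + p)) / n) (upTo n)
      C = S (λ q → χ (q + n <? a j)) (qs x)

    -- Ranks of vertices.

    rank : ℕ → ℕ
    rank t = S (λ k → χ (a k <? t)) (upTo n) + S (λ q → χ (q + n <? t)) (qs x)

    -- The path is closed (its end has label n p - p n = 0), so starts and ends of steps have the same labels.
    rank-ends : ∀ t → rank t ≡ S (λ k → χ (a k + p <? t)) (upTo n) + #< t (qs x)
    rank-ends t = sym (trans (cong (_+ #< t (qs x)) (sym (S-ns (λ u → χ (u + p <? t)))))
      (trans (telescope-closed (λ u → χ (u <? t)) (walk x)) (cong (_+ S (λ q → χ (q + n <? t)) (qs x)) (S-ns (λ u → χ (u <? t))))))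

    Start : ℕ → Set
    Start t = t ∈ ns x ⊎ (∃ λ q → q ∈ qs x × t ≡ q + n)

    rank-mono : ∀ {t u} → t ≤ u → rank t ≤ rank u
    rank-mono {t} {u} t≤u = +-mono-≤
      (S-mono (upTo n) λ k → χ-mono (a k <? t) (a k <? u) λ lt → <-≤-trans lt t≤u)
      (S-mono (qs x) λ q → χ-mono (q + n <? t) (q + n <? u) λ lt → <-≤-trans lt t≤u)

    -- The start `t` itself is counted in `rank u` but not in `rank t`.
    rank-strict : ∀ {t u} → Start t → t < u → rank t < rank u
    rank-strict {t} {u} (inj₁ t∈) t<u with ns⇒a t∈
    ... | k , k<n , refl = +-mono-<-≤
      (S-strict (upTo n) (λ k → χ-mono (a k <? t) (a k <? u) λ lt → <-trans lt t<u) (∈-upTo⁺ k<n) (χ-<-strict t<u))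
      (S-mono (qs x) λ q → χ-mono (q + n <? t) (q + n <? u) λ lt → <-trans lt t<u)
    rank-strict {t} {u} (inj₂ (q , q∈ , refl)) t<u = +-mono-≤-<
      (S-mono (upTo n) λ k → χ-mono (a k <? t) (a k <? u) λ lt → <-trans lt t<u)
      (S-strict (qs x) (λ q → χ-mono (q + n <? t) (q + n <? u) λ lt → <-trans lt t<u) q∈ (χ-<-strict t<u))

    rank-cancel-< : ∀ {t u} → rank t < rank u → t < u
    rank-cancel-< lt = ≰⇒> λ u≤t → <⇒≱ lt (rank-mono u≤t)

    rank-injective : ∀ {t u} → Start t → Start u → rank t ≡ rank u → t ≡ u
    rank-injective {t} {u} st su eq with <-cmp t u
    ... | tri< t<u _ _ = contradiction eq (<⇒≢ (rank-strict st t<u))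
    ... | tri≈ _ t≡u _ = t≡u
    ... | tri> _ _ u<t = contradiction (sym eq) (<⇒≢ (rank-strict su u<t))

    rank-0 : rank 0 ≡ 0
    rank-0 = cong₂ _+_ (zeros (upTo n) a) (zeros (qs x) (_+ n))
      where
      zeros : ∀ xs (f : ℕ → ℕ) → S (λ k → χ (f k <? 0)) xs ≡ 0
      zeros []       f = refl
      zeros (k ∷ xs) f = cong₂ _+_ (χ-no (f k <? 0) λ ()) (zeros xs f)

    length-qs : length (qs x) ≡ p
    length-qs = trans (length-eastEnds (walk x)) (numE x)

  -- Comparison of two paths with equal tableaux.

  module _ (x y : DyckPath n p)
    (same : ∀ i j → 1 ≤ i → i < j → j ≤ n → codinv n p x i j ≡ codinv n p y i j) where

    D-same : ∀ {i j} → j < n → D x i j ≡ D y i j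
    D-same {i} {j} j<n with i <? j
    ... | yes i<j = cong (χ (i <? j) *_) (same (suc i) (suc j) (s≤s z≤n) (s≤s i<j) j<n)
    ... | no i≮j  = trans (cong (_* codinv n p x (suc i) (suc j)) (χ-no (i <? j) i≮j)) (sym (cong (_* codinv n p y (suc i) (suc j)) (χ-no (i <? j) i≮j)))

    row-same : ∀ i → S (D x i) (upTo n) ≡ S (D y i) (upTo n)
    row-same i = S-cong (upTo n) λ j j∈ → D-same (∈-upTo⁻ j∈)

    -- Both paths have `p` East steps, so counts of large East ends determine counts of small ones.
    #<-from-#≥ : ∀ t u → S (λ q → χ (t ≤? q)) (qs x) ≡ S (λ q → χ (u ≤? q)) (qs y) → #< t (qs x) ≡ #< u (qs y)
    #<-from-#≥ t u eq = +-cancelʳ-≡ (S (λ q → χ (u ≤? q)) (qs y)) _ _ (begin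
      #< t (qs x) + S (λ q → χ (u ≤? q)) (qs y) ≡⟨ cong (#< t (qs x) +_) (sym eq) ⟩
      #< t (qs x) + S (λ q → χ (t ≤? q)) (qs x) ≡⟨ #<-#≥ t (qs x) ⟩
      length (qs x)                             ≡⟨ trans (length-qs x) (sym (length-qs y)) ⟩
      length (qs y)                             ≡⟨ sym (#<-#≥ u (qs y)) ⟩
      #< u (qs y) + S (λ q → χ (u ≤? q)) (qs y) ∎)
      where open ≡-Reasoning

    #<-north-end : ∀ {i} → i < n → #< (a x i + p) (qs x) ≡ #< (a y i + p) (qs y)
    #<-north-end {i} i<n = #<-from-#≥ (a x i + p) (a y i + p) (trans (sym (row-sum-≥ x i<n)) (trans (row-same i) (row-sum-≥ y i<n)))

    #≤-north-end : ∀ {i} → i < n → #< (suc (a x i + p)) (qs x) ≡ #< (suc (a y i + p)) (qs y)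
    #≤-north-end {i} i<n = #<-from-#≥ (suc (a x i + p)) (suc (a y i + p)) (trans (sym (row-sum-> x i<n)) (trans (row-same i) (row-sum-> y i<n)))

    a-<-same : ∀ {i j} → i < n → j < n → χ (a x i <? a x j) ≡ χ (a y i <? a y j)
    a-<-same {i} {j} i<n j<n = χ-cong (a x i <? a x j) (a y i <? a y j)
      (λ lt → a-strict y (a-cancel-< x i<n lt) j<n) (λ lt → a-strict x (a-cancel-< y i<n lt) j<n)

    -- Of the starts below `a j`, the North ones are determined by their indices and the East ones
    -- are counted by the column sum.
    rank-north : ∀ {j} → j < n → rank x (a x j) ≡ rank y (a y j)
    rank-north {j} j<n = cong₂ _+_
      (S-cong (upTo n) λ i i∈ → a-<-same (∈-upTo⁻ i∈) j<n)
      (trans (sym (column-sum x j<n)) (trans (S-cong (upTo n) λ i _ → D-same j<n) (column-sum y j<n)))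

    -- Rank is computed here from ends of steps: North ends compare like their starts, and East ends
    -- are counted through the row sum.
    rank-north-end : ∀ {j} → j < n → rank x (a x j + p) ≡ rank y (a y j + p)
    rank-north-end {j} j<n = trans (rank-ends x (a x j + p)) (trans (cong₂ _+_
        (S-cong (upTo n) λ i i∈ → trans (shift x i) (trans (a-<-same (∈-upTo⁻ i∈) j<n) (sym (shift y i))))
        (#<-north-end j<n)) (sym (rank-ends y (a y j + p))))
      where
      shift : ∀ z i → χ (a z i + p <? a z j + p) ≡ χ (a z i <? a z j)
      shift z i = χ-cong (a z i + p <? a z j + p) (a z i <? a z j) (+-cancelʳ-< p _ _) (+-monoˡ-< p)

    -- Equal ranks of the starts match the North starts below, hence by subtraction the number of
    -- East starts below. Translated by `n`, this is the number of East ends below `q`, which in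
    -- turn decides which North ends lie below `q`.
    rank-east-end : ∀ {q q′} → q ∈ qs x → q′ ∈ qs y → rank x (q + n) ≡ rank y (q′ + n) → rank x q ≡ rank y q′
    rank-east-end {q} {q′} q∈ q′∈ eq =
        trans (rank-ends x q) (trans (cong₂ _+_ (S-cong (upTo n) λ i i∈ → north-ends (∈-upTo⁻ i∈)) east-ends) (sym (rank-ends y q′)))
      where
      north-starts : ∀ {i} → i < n → χ (a x i <? q + n) ≡ χ (a y i <? q′ + n)
      north-starts {i} i<n = χ-cong (a x i <? q + n) (a y i <? q′ + n)
        (λ lt → rank-cancel-< y (subst₂ _<_ (rank-north i<n) eq (rank-strict x (inj₁ (a∈ns x i<n)) lt)))
        (λ lt → rank-cancel-< x (subst₂ _<_ (sym (rank-north i<n)) (sym eq) (rank-strict y (inj₁ (a∈ns y i<n)) lt)))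
      east-starts : S (λ r → χ (r + n <? q + n)) (qs x) ≡ S (λ r → χ (r + n <? q′ + n)) (qs y)
      east-starts = +-cancelˡ-≡ (S (λ k → χ (a x k <? q + n)) (upTo n)) _ _
        (trans eq (cong (_+ S (λ r → χ (r + n <? q′ + n)) (qs y)) (sym (S-cong (upTo n) λ i i∈ → north-starts (∈-upTo⁻ i∈)))))
      shift : ∀ z r → S (λ s → χ (s + n <? r + n)) (qs z) ≡ #< r (qs z)
      shift z r = S-cong (qs z) λ s _ → χ-cong (s + n <? r + n) (s <? r) (+-cancelʳ-< n _ _) (+-monoˡ-< n)
      east-ends : #< q (qs x) ≡ #< q′ (qs y)
      east-ends = trans (sym (shift x q)) (trans east-starts (shift y q′))
      -- If `r < t`, the East end `r` would be counted below `t` but not below `r`.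
      below-end : ∀ z {r t} → r ∈ qs z → #< t (qs z) ≤ #< r (qs z) → t ≤ r
      below-end z r∈ le = ≮⇒≥ λ r<t → <⇒≱ (#<-strict (qs z) r∈ r<t) le
      north-ends : ∀ {i} → i < n → χ (a x i + p <? q) ≡ χ (a y i + p <? q′)
      north-ends {i} i<n = χ-cong (a x i + p <? q) (a y i + p <? q′)
        (λ lt → below-end y q′∈ (subst₂ _≤_ (#≤-north-end i<n) east-ends (#<-mono (qs x) lt)))
        (λ lt → below-end x q∈ (subst₂ _≤_ (sym (#≤-north-end i<n)) (sym east-ends) (#<-mono (qs y) lt)))

    -- Induction along both walks with equal ranks of the current vertices as invariant. A North
    -- step facing an East step is impossible: equal ranks would put the start of the East step at a
    -- North label of its own path. Equal lengths prevent one walk from stopping first.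
    follow : ∀ {v v′ s s′ w w′} (V : Walk v s w) (V′ : Walk v′ s′ w′) →
      (∀ {u} → u ∈ norths V → u ∈ ns x) → (∀ {q} → q ∈ eastEnds V → q ∈ qs x) →
      (∀ {u} → u ∈ norths V′ → u ∈ ns y) → (∀ {q} → q ∈ eastEnds V′ → q ∈ qs y) →
      rank x v ≡ rank y v′ → length s ≡ length s′ → s ≡ s′
    follow done done _ _ _ _ _ _ = refl
    follow {v} {v′} (north V) (north V′) nV eV nV′ eV′ eq len with ns⇒a x (nV (here refl))
    ... | k , k<n , refl = cong (N ∷_) (follow V V′ (nV ∘ there) eV (nV′ ∘ there) eV′
            (subst (λ z → rank x (a x k + p) ≡ rank y (z + p)) v′≡ (rank-north-end k<n)) (suc-injective len))
      where
      v′≡ : a y k ≡ v′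
      v′≡ = rank-injective y (inj₁ (a∈ns y k<n)) (inj₁ (nV′ (here refl))) (trans (sym (rank-north k<n)) eq)
    follow (north V) (east {q} V′) nV eV nV′ eV′ eq len with ns⇒a x (nV (here refl))
    ... | k , k<n , refl = contradiction (subst (_∈ ns y) v′≡ (a∈ns y k<n)) (east-start∉ns y (eV′ (here refl)))
      where
      v′≡ : a y k ≡ q + n
      v′≡ = rank-injective y (inj₁ (a∈ns y k<n)) (inj₂ (q , eV′ (here refl) , refl)) (trans (sym (rank-north k<n)) eq)
    follow (east {q} V) (north V′) nV eV nV′ eV′ eq len with ns⇒a y (nV′ (here refl))
    ... | k , k<n , refl = contradiction (subst (_∈ ns x) v≡ (a∈ns x k<n)) (east-start∉ns x (eV (here refl)))
      where
      v≡ : a x k ≡ q + n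
      v≡ = rank-injective x (inj₁ (a∈ns x k<n)) (inj₂ (q , eV (here refl) , refl)) (trans (rank-north k<n) (sym eq))
    follow (east V) (east V′) nV eV nV′ eV′ eq len = cong (E ∷_) (follow V V′ nV (eV ∘ there) nV′ (eV′ ∘ there)
      (rank-east-end (eV (here refl)) (eV′ (here refl)) eq) (suc-injective len))

    path-same : path x ≡ path y
    path-same = follow (walk x) (walk y) id id id id (trans (rank-0 x) (sym (rank-0 y)))
      (trans (length-path (path x)) (trans (cong₂ _+_ (trans (numN x) (sym (numN y))) (trans (numE x) (sym (numE y)))) (sym (length-path (path y)))))

theorem3p6 : (n p : ℕ) → 1 ≤ n → 1 ≤ p → Coprime n p →
    (x y : DyckPath n p) →
    (∀ i j → 1 ≤ i → i < j → j ≤ n → codinv n p x i j ≡ codinv n p y i j) →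
    path x ≡ path y
theorem3p6 n p 1≤n 1≤p cop x y same = Paths.path-same n p {{>-nonZero 1≤n}} {{>-nonZero 1≤p}} cop x y same
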